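{- Let $\mathcal{I}=(V,E,w,m,Q,D)$ be a VRP instance with complete graph $G_s=(V,E,w)$. Let $\mathcal{F}_{\mathrm{VRP}}$ be the set of feasible VRP solutions of $\mathcal{I}$ and let $\mathcal{F}$ be the set of feasible routing graphs of $\mathcal{I}$. Let $\operatorname{GED}(G_s,G_t)$ be the graph edit distance with edge deletion costs $c_{\mathrm{del}}(e)=w(e)$ and edge insertion costs $c_{\mathrm{ins}}(e)=0$, and let $W_{\mathrm{total}}=\sum_{e\in E}w(e)$. Then $$\min_{\mathcal{R}\in\mathcal{F}_{\mathrm{VRP}}} C(\mathcal{R}) \;=\; W_{\mathrm{total}}-\max_{G_t\in\mathcal{F}}\operatorname{GED}(G_s,G_t).$$
   Context: VRP instance: a tuple $\mathcal{I}=(V,E,w,m,Q,D)$ where $V=\{0,1,\dots,n\}$ ($0$ is the depot, $1,\dots,n$ are the customers); $E=\{(i,j): i,j\in V,\ i\ne j\}$ is the set of all ordered pairs (directed arcs); $w:E\to\mathbb{R}^+$ (positive reals) is symmetric, $w(i,j)=w(j,i)$, and satisfies the triangle inequality $w(i,j)\le w(i,k)+w(k,j)$; $m$ is a positive integer (number of vehicles); $Q>0$ is the vehicle capacity; $D=(d_1,\dots,d_n)$ are real customer demands with $d_i\le Q$ for all $i$. The complete graph is $G_s=(V,E,w)$. Feasible VRP solution: a family $\mathcal{R}=\{R_1,\dots,R_m\}$ of $m$ routes $R_k=(v_0^k,v_1^k,\dots,v_{l_k}^k)$ such that $v_0^k=v_{l_k}^k=0$; the intermediate vertices $v_1^k,\dots,v_{l_k-1}^k$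 are customers, and there is at least one of them; every customer occurs exactly once among all intermediate positions of all routes; and for each $k$ the total demand of the customers of $R_k$ is at most $Q$. Its cost is $C(\mathcal{R})=\sum_{k=1}^m\sum_{i=0}^{l_k-1}w(v_i^k,v_{i+1}^k)$. Feasible routing graph: a directed subgraph $G_t=(V,E_t)$, $E_t\subseteq E$, of $G_s$ such that (1) $\deg^+(0)=\deg^-(0)=m$; (2) $\deg^+(i)=\deg^-(i)=1$ for all $i\in\{1,\dots,n\}$; (3) $G_t$ decomposes into $m$ edge-disjoint directed cycles, each starting and ending at the depot, the cycles sharing only the depot vertex; (4) for each of these cycles, the total demand of its customers is at most $Q$. Graph edit distance: for graphs on the same vertex set $V$ with edge sets $E_1,E_2$ (vertices being matched identically, so no vertex edits), $\operatorname{GED}(G_1,G_2)=\sum_{e\in E_1\setminus E_2}c_{\mathrm{del}}(e)+\sum_{e\in E_2\setminus E_1}c_{\mathrm{ins}}(e)$. Convention: if no feasible solution exists, the minimum over the empty set is $+\infty$ and the maximum over the empty set is $-\infty$. -}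

module Defs where

open import Algebra.Bundles using (module CommutativeMonoid)
open import Algebra.Bundles.Raw using (RawMonoid)
import Algebra.Definitions.RawMonoid as RawMonoidDefinitions
import Algebra.Properties.CommutativeSemigroup as CommutativeSemigroupProperties
open import Data.Bool.Base using (Bool; T; not; _∧_; if_then_else_)
open import Data.Empty using (⊥)
open import Data.Fin.Base using (Fin; zero; suc)
open import Data.Fin.Properties using (_≟_)
open import Data.Fin.Subset using (∣_∣)
open import Data.List.Base using (List; []; _∷_; _∷ʳ_; map; foldr; length; lookup)
open import Data.List.Membership.Propositional using (_∈_)
open import Data.List.NonEmpty.Base using (List⁺; toList)
open import Data.List.Relation.Unary.Unique.Propositional using (Unique)
open import Data.Nat.Base as ℕ using (ℕ; suc)
import Data.Nat.Properties as ℕ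
open import Data.Product using (Σ; ∃; ∃!; _×_; _,_; uncurry)
open import Data.Rational.Base as ℚ using (ℚ; 0ℚ; ½)
import Data.Rational.Properties as ℚ
open import Data.Vec.Base using (tabulate)
open import Function.Bundles using (_⇔_)
open import Level using (0ℓ)
import Relation.Binary.Construct.Add.Extrema.Equality as AddExtrema
open import Relation.Binary.PropositionalEquality
  using (_≡_; _≢_; refl; sym; trans; cong; subst)
open import Relation.Nullary.Construct.Add.Extrema using (_±; ⊥±; [_]; ⊤±)
open import Relation.Nullary.Decidable.Core using (does)
open import Relation.Nullary.Negation.Core using (¬_)

-- Real numbers: Cauchy sequences of rationals, under the setoid
-- equality _≈ℝ_.

IsCauchy : (ℕ → ℚ) → Set
IsCauchy s = ∀ ε → 0ℚ ℚ.< ε →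
  ∃ λ N → ∀ p q → N ℕ.≤ p → N ℕ.≤ q → ℚ.∣ s p ℚ.- s q ∣ ℚ.< ε

record ℝ : Set where
  constructor mkℝ
  field
    seq    : ℕ → ℚ
    cauchy : IsCauchy seq

open ℝ public

infix 4 _≈ℝ_ _≤ℝ_ _<ℝ_

_≈ℝ_ : ℝ → ℝ → Set
x ≈ℝ y = ∀ ε → 0ℚ ℚ.< ε →
  ∃ λ N → ∀ p → N ℕ.≤ p → ℚ.∣ seq x p ℚ.- seq y p ∣ ℚ.< ε

_≤ℝ_ : ℝ → ℝ → Set
x ≤ℝ y = ∀ ε → 0ℚ ℚ.< ε →
  ∃ λ N → ∀ p → N ℕ.≤ p → seq x p ℚ.≤ seq y p ℚ.+ ε

_<ℝ_ : ℝ → ℝ → Set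
x <ℝ y = ∃ λ ε → 0ℚ ℚ.< ε ×
  ∃ λ N → ∀ p → N ℕ.≤ p → seq x p ℚ.+ ε ℚ.≤ seq y p

0ℝ : ℝ
0ℝ = mkℝ (λ _ → 0ℚ) (λ ε 0<ε → 0 , λ _ _ _ _ → 0<ε)

-- abstract: unfolding these proofs makes checking very slow.
private abstract
  half-pos : ∀ ε → 0ℚ ℚ.< ε → 0ℚ ℚ.< ½ ℚ.* ε
  half-pos ε 0<ε =
    subst (ℚ._< ½ ℚ.* ε) (ℚ.*-zeroʳ ½) (ℚ.*-monoʳ-<-pos ½ 0<ε)

  halves : ∀ ε → ½ ℚ.* ε ℚ.+ ½ ℚ.* ε ≡ ε
  halves ε = trans (sym (ℚ.*-distribʳ-+ ε ½ ½)) (ℚ.*-identityˡ ε)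

  interchange : ∀ a b c d →
    (a ℚ.+ b) ℚ.- (c ℚ.+ d) ≡ (a ℚ.- c) ℚ.+ (b ℚ.- d)
  interchange a b c d =
    trans (cong ((a ℚ.+ b) ℚ.+_) (ℚ.neg-distrib-+ c d))
          (medial a b (ℚ.- c) (ℚ.- d))
    where open CommutativeSemigroupProperties
            (CommutativeMonoid.commutativeSemigroup ℚ.+-0-commutativeMonoid)
            renaming (interchange to medial)

  +-cauchy : ∀ s t → IsCauchy s → IsCauchy t → IsCauchy (λ p → s p ℚ.+ t p)
  +-cauchy s t cs ct ε 0<ε
    with cs (½ ℚ.* ε) (half-pos ε 0<ε) | ct (½ ℚ.* ε) (half-pos ε 0<ε)
  ... | M , hM | N , hN = M ℕ.⊔ N , λ p q hp hq →
    let |s| = hM p q (ℕ.≤-trans (ℕ.m≤m⊔n M N) hp) (ℕ.≤-trans (ℕ.m≤m⊔n M N) hq)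
        |t| = hN p q (ℕ.≤-trans (ℕ.m≤n⊔m M N) hp) (ℕ.≤-trans (ℕ.m≤n⊔m M N) hq)
    in begin-strict
      ℚ.∣ (s p ℚ.+ t p) ℚ.- (s q ℚ.+ t q) ∣
        ≡⟨ cong ℚ.∣_∣ (interchange (s p) (t p) (s q) (t q)) ⟩
      ℚ.∣ (s p ℚ.- s q) ℚ.+ (t p ℚ.- t q) ∣
        ≤⟨ ℚ.∣p+q∣≤∣p∣+∣q∣ (s p ℚ.- s q) (t p ℚ.- t q) ⟩
      ℚ.∣ s p ℚ.- s q ∣ ℚ.+ ℚ.∣ t p ℚ.- t q ∣
        <⟨ ℚ.+-mono-< |s| |t| ⟩
      ½ ℚ.* ε ℚ.+ ½ ℚ.* ε
        ≡⟨ halves ε ⟩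
      ε ∎
    where open ℚ.≤-Reasoning

  neg-cauchy : ∀ s → IsCauchy s → IsCauchy (λ p → ℚ.- s p)
  neg-cauchy s cs ε 0<ε with cs ε 0<ε
  ... | N , h = N , λ p q hp hq →
    subst (ℚ._< ε)
      (trans (sym (ℚ.∣-p∣≡∣p∣ (s p ℚ.- s q)))
             (cong ℚ.∣_∣ (ℚ.neg-distrib-+ (s p) (ℚ.- s q))))
      (h p q hp hq)

infixl 6 _+ℝ_ _-ℝ_
infix  8 -ℝ_

_+ℝ_ : ℝ → ℝ → ℝ
x +ℝ y = mkℝ (λ p → seq x p ℚ.+ seq y p) (+-cauchy (seq x) (seq y) (cauchy x) (cauchy y))

-ℝ_ : ℝ → ℝ
-ℝ x = mkℝ (λ p → ℚ.- seq x p) (neg-cauchy (seq x) (cauchy x))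

_-ℝ_ : ℝ → ℝ → ℝ
x -ℝ y = x +ℝ (-ℝ y)

+ℝ-rawMonoid : RawMonoid 0ℓ 0ℓ
+ℝ-rawMonoid = record { Carrier = ℝ ; _≈_ = _≈ℝ_ ; _∙_ = _+ℝ_ ; ε = 0ℝ }

open RawMonoidDefinitions +ℝ-rawMonoid public using (sum)

sumᴸ : List ℝ → ℝ
sumᴸ = foldr _+ℝ_ 0ℝ

-- Extended reals, with ⊥± = -∞ and ⊤± = +∞

open AddExtrema _≈ℝ_ public using (_≈±_)

infixl 6 _-±_

_-±_ : ℝ → ℝ ± → ℝ ±
x -± ⊥±    = ⊤±
x -± [ y ] = [ x -ℝ y ]
x -± ⊤±    = ⊥±

-- The minimum (maximum) of f over A is an attained value; if A is empty
-- it is +∞ (-∞).  Such a value is unique up to _≈±_; that one exists, even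
-- for finite A, needs excluded middle, as _≤ℝ_ is not decidable.

IsMinimum : {A : Set} → (A → ℝ) → ℝ ± → Set
IsMinimum     f ⊥±    = ⊥
IsMinimum     f [ x ] = (∃ λ a → f a ≈ℝ x) × (∀ a → x ≤ℝ f a)
IsMinimum {A} f ⊤±    = ¬ A

IsMaximum : {A : Set} → (A → ℝ) → ℝ ± → Set
IsMaximum {A} f ⊥±    = ¬ A
IsMaximum     f [ x ] = (∃ λ a → f a ≈ℝ x) × (∀ a → f a ≤ℝ x)
IsMaximum     f ⊤±    = ⊥

Digraph : ℕ → Set
Digraph N = Fin N → Fin N → Bool

complete : ∀ {N} → Digraph N
complete i j = not (does (i ≟ j))

outdeg indeg : ∀ {N} → Digraph N → Fin N → ℕ
outdeg G i = ∣ tabulate (λ j → G i j) ∣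
indeg  G i = ∣ tabulate (λ j → G j i) ∣

_∖_ : ∀ {N} → Digraph N → Digraph N → Digraph N
(G ∖ H) i j = G i j ∧ not (H i j)

arcSum : ∀ {N} → Digraph N → (Fin N → Fin N → ℝ) → ℝ
arcSum G c = sum λ i → sum λ j → if G i j then c i j else 0ℝ

GED : ∀ {N} (c-del c-ins : Fin N → Fin N → ℝ) → Digraph N → Digraph N → ℝ
GED c-del c-ins G H = arcSum (G ∖ H) c-del +ℝ arcSum (H ∖ G) c-ins

-- Customer c : Fin n is the vertex suc c; the depot is the vertex zero.
-- Arcs join distinct vertices, so the diagonal values w i i are
-- unconstrained; nothing below depends on them.

record Instance : Set where
  field
    n m      : ℕ
    w        : Fin (suc n) → Fin (suc n) → ℝ
    Q        : ℝ
    d        : Fin n → ℝ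
    w-pos    : ∀ {i j} → i ≢ j → 0ℝ <ℝ w i j
    w-sym    : ∀ {i j} → i ≢ j → w i j ≈ℝ w j i
    triangle : ∀ {i j k} → i ≢ j → i ≢ k → k ≢ j → w i j ≤ℝ w i k +ℝ w k j
    m-pos    : 0 ℕ.< m
    Q-pos    : 0ℝ <ℝ Q
    d≤Q      : ∀ c → d c ≤ℝ Q

consecutive : {A : Set} → List A → List (A × A)
consecutive []           = []
consecutive (_ ∷ [])     = []
consecutive (x ∷ y ∷ zs) = (x , y) ∷ consecutive (y ∷ zs)

module _ (I : Instance) where
  open Instance I

  Vertex Customer : Set
  Vertex   = Fin (suc n)
  Customer = Fin n

  depot : Vertex
  depot = zero

  G-s : Digraph (suc n)
  G-s = complete

  W-total : ℝ
  W-total = arcSum G-s w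

  -- A tour (0, v₁, …, vₗ₋₁, 0) is given by its nonempty list of
  -- intermediate vertices, all of them customers.
  Tour : Set
  Tour = List⁺ Customer

  vertices : Tour → List Vertex
  vertices t = (depot ∷ map suc (toList t)) ∷ʳ depot

  arcs : Tour → List (Vertex × Vertex)
  arcs t = consecutive (vertices t)

  load : Tour → ℝ
  load t = sumᴸ (map d (toList t))

  length-of : Tour → ℝ
  length-of t = sumᴸ (map (uncurry w) (arcs t))

  Position : (Fin m → Tour) → Set
  Position R = Σ (Fin m) λ k → Fin (length (toList (R k)))

  customerAt : (R : Fin m → Tour) → Position R → Customer
  customerAt R (k , p) = lookup (toList (R k)) p

  record IsFeasibleSolution (R : Fin m → Tour) : Set where
    field
      exactly-once : ∀ c → ∃! _≡_ λ pos → customerAt R pos ≡ c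
      capacity     : ∀ k → load (R k) ≤ℝ Q

  FeasibleSolution : Set
  FeasibleSolution = ∃ IsFeasibleSolution

  cost : FeasibleSolution → ℝ
  cost (R , _) = sum λ k → length-of (R k)

  -- The graph is loopless, so every directed cycle through the depot
  -- visits a customer and is a tour without repeated customers.
  record IsCycleDecomposition (G : Digraph (suc n)) (C : Fin m → Tour) : Set where
    field
      simple        : ∀ k → Unique (toList (C k))
      edges         : ∀ i j → T (G i j) ⇔ ∃ λ k → (i , j) ∈ arcs (C k)
      edge-disjoint : ∀ {k l e} → k ≢ l → e ∈ arcs (C k) → ¬ e ∈ arcs (C l)
      share-depot   : ∀ {k l v} → k ≢ l →
                      v ∈ vertices (C k) → v ∈ vertices (C l) → v ≡ depot

  record IsFeasibleGraph (G : Digraph (suc n)) : Set where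
    field
      subgraph      : ∀ i j → T (G i j) → T (G-s i j)
      depot-out     : outdeg G depot ≡ m
      depot-in      : indeg  G depot ≡ m
      customer-out  : ∀ (c : Customer) → outdeg G (suc c) ≡ 1
      customer-in   : ∀ (c : Customer) → indeg  G (suc c) ≡ 1
      cycles        : Fin m → Tour
      decomposition : IsCycleDecomposition G cycles
      capacity      : ∀ k → load (cycles k) ≤ℝ Q

  FeasibleGraph : Set
  FeasibleGraph = ∃ IsFeasibleGraph

  ged : FeasibleGraph → ℝ
  ged (G-t , _) = GED w (λ _ _ → 0ℝ) G-s G-t

{-# OPTIONS --safe #-}
module Submission where

-- The arcs of a family of routes form a graph, and the cycles of a feasible
-- graph form a family of routes; feasibility carries over both ways, and the
-- cost of the family is the weight of the graph, since each arc is used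
-- exactly once.  As GED(G-s, G) + weight G = W-total, a lightest feasible
-- graph attains both extrema.  One exists because there are finitely many
-- digraphs and excluded middle makes _≤ℝ_ total.

open import Defs
open import Algebra.Bundles using (CommutativeMonoid; AbelianGroup)
import Algebra.Properties.CommutativeMonoid.Sum as CommutativeMonoidSum
import Algebra.Properties.Group as GroupProperties
open import Axiom.ExcludedMiddle using (ExcludedMiddle)
open import Data.Bool.Base using (Bool; true; false; T; not; _∧_; if_then_else_)
open import Data.Fin.Base using (Fin; zero; suc; funToFin; finToFun)
open import Data.Fin.Properties using (_≟_; suc-injective; finToFun-funToFin; 2↔Bool)
open import Data.Fin.Subset using (∣_∣)
open import Data.List.Base
  using (List; []; _∷_; _∷ʳ_; _++_; map; foldr; concat; tabulate; lookup; allFin)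
open import Data.List.Membership.Propositional using (_∈_; _∉_)
open import Data.List.Membership.Propositional.Properties
  using (∈-map⁺; ∈-map⁻; ∈-++⁺ˡ; ∈-++⁻; ∈-concat⁺′; ∈-concat⁻′;
         ∈-tabulate⁺; ∈-tabulate⁻; ∈-allFin; ∈-lookup)
import Data.List.Membership.DecPropositional as DecMembership
open import Data.List.NonEmpty.Base using (toList) renaming (_∷_ to _∷⁺_)
open import Data.List.Properties using (map-∘; tabulate-lookup)
import Data.List.Relation.Unary.All as All
import Data.List.Relation.Unary.All.Properties as All
open import Data.List.Relation.Unary.AllPairs using ([]; _∷_)
import Data.List.Relation.Unary.AllPairs.Properties as AllPairs
open import Data.List.Relation.Unary.Any using (here; there; index)
open import Data.List.Relation.Unary.Any.Properties using (lookup-index)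
open import Data.List.Relation.Unary.Unique.Propositional using (Unique)
import Data.List.Relation.Unary.Unique.Propositional.Properties as Unique
open import Data.Nat.Base as ℕ using (ℕ)
import Data.Nat.Properties as ℕ
open import Data.Product.Base using (∃; ∃₂; _×_; _,_; proj₁; proj₂; uncurry)
open import Data.Product.Properties using (≡-dec)
open import Data.Rational.Base as ℚ using (ℚ; 0ℚ; ½)
import Data.Rational.Properties as ℚ
open import Data.Sum.Base using (_⊎_; inj₁; inj₂)
import Data.Vec.Base as Vec
open import Function.Base using (_∘_; case_of_)
open import Function.Bundles using (_⇔_; mk⇔; Equivalence; Inverse)
open import Level using (0ℓ)
open import Relation.Binary.Construct.Add.Extrema.Equality _≈ℝ_ using (≈±-refl)
open import Relation.Binary.PropositionalEquality
  using (_≡_; _≢_; refl; sym; trans; cong; cong₂; subst; subst₂; module ≡-Reasoning)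
import Relation.Binary.Reasoning.Setoid as SetoidReasoning
open import Relation.Nullary.Construct.Add.Extrema using (_±; ⊥±; [_]; ⊤±)
open import Relation.Nullary.Decidable using (Dec; yes; no; does; dec-true; dec-false)
open import Relation.Nullary.Negation using (¬_; contradiction)

open Equivalence using (to; from)

-- Real numbers

infix 4 _≐_

-- Every identity needed between sums of weights already holds at each index
-- of the sequences, so this finer relation can replace _≈ℝ_ in them.
_≐_ : ℝ → ℝ → Set
x ≐ y = ∀ p → seq x p ≡ seq y p

+-abelianGroup : AbelianGroup 0ℓ 0ℓ
+-abelianGroup = record
  { Carrier = ℝ ; _≈_ = _≐_ ; _∙_ = _+ℝ_ ; ε = 0ℝ ; _⁻¹ = -ℝ_
  ; isAbelianGroup = record
    { isGroup = record
      { isMonoid = record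
        { isSemigroup = record
          { isMagma = record
            { isEquivalence = record
              { refl  = λ _ → refl
              ; sym   = λ e p → sym (e p)
              ; trans = λ e f p → trans (e p) (f p)
              }
            ; ∙-cong = λ e f p → cong₂ ℚ._+_ (e p) (f p)
            }
          ; assoc = λ x y z p → ℚ.+-assoc (seq x p) (seq y p) (seq z p)
          }
        ; identity = (λ x p → ℚ.+-identityˡ (seq x p)) , (λ x p → ℚ.+-identityʳ (seq x p))
        }
      ; inverse = (λ x p → ℚ.+-inverseˡ (seq x p)) , (λ x p → ℚ.+-inverseʳ (seq x p))
      ; ⁻¹-cong = λ e p → cong ℚ.-_ (e p)
      }
    ; comm = λ x y p → ℚ.+-comm (seq x p) (seq y p)
    }
  }

module ≐ = AbelianGroup +-abelianGroup
module ℚ+ = GroupProperties ℚ.+-0-group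

≐⇒≈ : ∀ {x y} → x ≐ y → x ≈ℝ y
≐⇒≈ {x} {y} x≐y ε 0<ε = 0 , λ p _ →
  subst (λ q → ℚ.∣ q ∣ ℚ.< ε)
    (sym (trans (cong (λ q → q ℚ.- seq y p) (x≐y p)) (ℚ.+-inverseʳ (seq y p)))) 0<ε

≤-refl : ∀ {x} → x ≤ℝ x
≤-refl {x} ε 0<ε = 0 , λ p _ →
  subst (ℚ._≤ seq x p ℚ.+ ε) (ℚ.+-identityʳ (seq x p)) (ℚ.+-monoʳ-≤ (seq x p) (ℚ.<⇒≤ 0<ε))

≤-resp-≐ : ∀ {x x′ y y′} → x ≐ x′ → y ≐ y′ → x ≤ℝ y → x′ ≤ℝ y′
≤-resp-≐ x≐x′ y≐y′ x≤y ε 0<ε with x≤y ε 0<ε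
... | N , h = N , λ p N≤p → subst₂ (λ a b → a ℚ.≤ b ℚ.+ ε) (x≐x′ p) (y≐y′ p) (h p N≤p)

≤-reflexive : ∀ {x y} → x ≐ y → x ≤ℝ y
≤-reflexive {x} {y} x≐y = ≤-resp-≐ {x} {x} {x} {y} (λ _ → refl) x≐y (≤-refl {x})

half-positive : ∀ {ε} → 0ℚ ℚ.< ε → 0ℚ ℚ.< ½ ℚ.* ε
half-positive {ε} 0<ε = subst (ℚ._< ½ ℚ.* ε) (ℚ.*-zeroʳ ½) (ℚ.*-monoʳ-<-pos ½ 0<ε)

half+half : ∀ q ε → q ℚ.+ ½ ℚ.* ε ℚ.+ ½ ℚ.* ε ≡ q ℚ.+ ε
half+half q ε = trans (ℚ.+-assoc q (½ ℚ.* ε) (½ ℚ.* ε))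
  (cong (q ℚ.+_) (trans (sym (ℚ.*-distribʳ-+ ε ½ ½)) (ℚ.*-identityˡ ε)))

≤-trans : ∀ {x y z} → x ≤ℝ y → y ≤ℝ z → x ≤ℝ z
≤-trans {x} {y} {z} x≤y y≤z ε 0<ε
  with x≤y (½ ℚ.* ε) (half-positive 0<ε) | y≤z (½ ℚ.* ε) (half-positive 0<ε)
... | M , hM | N , hN = M ℕ.⊔ N , λ p hp → begin
  seq x p                              ≤⟨ hM p (ℕ.≤-trans (ℕ.m≤m⊔n M N) hp) ⟩
  seq y p ℚ.+ ½ ℚ.* ε                  ≤⟨ ℚ.+-monoˡ-≤ (½ ℚ.* ε) (hN p (ℕ.≤-trans (ℕ.m≤n⊔m M N) hp)) ⟩
  seq z p ℚ.+ ½ ℚ.* ε ℚ.+ ½ ℚ.* ε      ≡⟨ half+half (seq z p) ε ⟩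
  seq z p ℚ.+ ε                        ∎
  where open ℚ.≤-Reasoning

-‿anti-≤ : ∀ {x y} w → x ≤ℝ y → w -ℝ y ≤ℝ w -ℝ x
-‿anti-≤ {x} {y} w x≤y ε 0<ε with x≤y ε 0<ε
... | N , h = N , λ p N≤p → let a = seq x p ; b = seq y p ; c = seq w p in begin
  -- `- ε + ε` is inserted so that the negated hypothesis `- (b + ε) ≤ - a` can be applied inside
  -- the sum.
  c ℚ.- b                      ≡⟨ cong (c ℚ.+_) (ℚ+.//-rightDividesˡ ε (ℚ.- b)) ⟨
  c ℚ.+ (ℚ.- b ℚ.- ε ℚ.+ ε)    ≡⟨ cong (λ q → c ℚ.+ (q ℚ.+ ε)) (ℚ.neg-distrib-+ b ε) ⟨
  c ℚ.+ (ℚ.- (b ℚ.+ ε) ℚ.+ ε)  ≤⟨ ℚ.+-monoʳ-≤ c (ℚ.+-monoˡ-≤ ε (ℚ.neg-antimono-≤ (h p N≤p))) ⟩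
  c ℚ.+ (ℚ.- a ℚ.+ ε)          ≡⟨ ℚ.+-assoc c (ℚ.- a) ε ⟨
  c ℚ.- a ℚ.+ ε                ∎
  where open ℚ.≤-Reasoning

p≤∣p∣ : ∀ p → p ℚ.≤ ℚ.∣ p ∣
p≤∣p∣ p with ℚ.≤-total 0ℚ p
... | inj₁ 0≤p = ℚ.≤-reflexive (sym (ℚ.0≤p⇒∣p∣≡p 0≤p))
... | inj₂ p≤0 = ℚ.≤-trans p≤0 (ℚ.0≤∣p∣ p)

p-q≤r⇒p≤q+r : ∀ p q {r} → p ℚ.- q ℚ.≤ r → p ℚ.≤ q ℚ.+ r
p-q≤r⇒p≤q+r p q {r} p-q≤r =
  subst₂ ℚ._≤_ (ℚ+.//-rightDividesˡ q p) (ℚ.+-comm r q) (ℚ.+-monoˡ-≤ q p-q≤r)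

∣p-q∣<r⇒p≤q+r : ∀ p q {r} → ℚ.∣ p ℚ.- q ∣ ℚ.< r → p ℚ.≤ q ℚ.+ r
∣p-q∣<r⇒p≤q+r p q ∣p-q∣<r =
  p-q≤r⇒p≤q+r p q (ℚ.≤-trans (p≤∣p∣ (p ℚ.- q)) (ℚ.<⇒≤ ∣p-q∣<r))

0≤q-p⇒p≤q : ∀ p q → 0ℚ ℚ.≤ q ℚ.- p → p ℚ.≤ q
0≤q-p⇒p≤q p q 0≤q-p =
  subst₂ ℚ._≤_ (ℚ.+-identityˡ p) (ℚ+.//-rightDividesˡ p q) (ℚ.+-monoˡ-≤ p 0≤q-p)

r≤q+r⇒0≤q : ∀ q r → r ℚ.≤ q ℚ.+ r → 0ℚ ℚ.≤ q
r≤q+r⇒0≤q q r r≤q+r =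
  subst₂ ℚ._≤_ (ℚ.+-inverseʳ r) (ℚ+.//-rightDividesʳ r q) (ℚ.+-monoˡ-≤ (ℚ.- r) r≤q+r)

-- If y - x is not eventually nonnegative then, being Cauchy, it is
-- eventually below every ε > 0.
≤-total : ExcludedMiddle 0ℓ → ∀ x y → x ≤ℝ y ⊎ y ≤ℝ x
≤-total em x y with em {∃ λ N → ∀ p → N ℕ.≤ p → seq x p ℚ.≤ seq y p}
... | yes (N , h) = inj₁ λ ε 0<ε → N , λ p N≤p →
  subst (ℚ._≤ seq y p ℚ.+ ε) (ℚ.+-identityʳ (seq x p)) (ℚ.+-mono-≤ (h p N≤p) (ℚ.<⇒≤ 0<ε))
... | no ¬x≤y = inj₂ y≤x
  where
  z = y -ℝ x
  y≤x : y ≤ℝ x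
  y≤x ε 0<ε with cauchy z (½ ℚ.* ε) (half-positive 0<ε)
  ... | N , h with ℚ.≤-total (seq z N) (½ ℚ.* ε)
  ... | inj₁ small = N , λ p N≤p → p-q≤r⇒p≤q+r (seq y p) (seq x p) (begin
        seq z p                    ≤⟨ ∣p-q∣<r⇒p≤q+r (seq z p) (seq z N) (h p N N≤p ℕ.≤-refl) ⟩
        seq z N ℚ.+ ½ ℚ.* ε        ≤⟨ ℚ.+-monoˡ-≤ (½ ℚ.* ε) small ⟩
        ½ ℚ.* ε ℚ.+ ½ ℚ.* ε        ≡⟨ ℚ.*-distribʳ-+ ε ½ ½ ⟨
        (½ ℚ.+ ½) ℚ.* ε            ≡⟨ ℚ.*-identityˡ ε ⟩
        ε                          ∎)
    where open ℚ.≤-Reasoning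
  ... | inj₂ large = contradiction (N , λ p N≤p → 0≤q-p⇒p≤q (seq x p) (seq y p)
        (r≤q+r⇒0≤q (seq z p) (½ ℚ.* ε)
          (ℚ.≤-trans large (∣p-q∣<r⇒p≤q+r (seq z N) (seq z p) (h N p ℕ.≤-refl N≤p))))) ¬x≤y

-- `A` itself need not be finite. Elements with equal codes have mutually comparable values, so it
-- suffices to compare one representative for each code that occurs.
minimiser : ExcludedMiddle 0ℓ → ∀ {A : Set} {K} (f : A → ℝ) (code : A → Fin K) →
  (∀ {a b} → code a ≡ code b → f a ≤ℝ f b) → A → ∃ λ a → ∀ b → f a ≤ℝ f b
minimiser em {A} {K} f code code-≤ a₀ with go (allFin K)
  where
  -- The invariant restricts minimality to the codes scanned so far; for the empty list any element
  -- will do, hence the given `a₀`.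
  go : ∀ ks → ∃ λ a → ∀ b → code b ∈ ks → f a ≤ℝ f b
  go []       = a₀ , λ _ ()
  go (k ∷ ks) with go ks | em {∃ λ a → code a ≡ k}
  ... | a , a≤ | no ∄a′ = a , λ where
    b (here b≡k)   → contradiction (b , b≡k) ∄a′
    b (there b∈ks) → a≤ b b∈ks
  -- The lesser of the old candidate and the representative `a′` of the new code survives; `code-≤`
  -- passes from `a′` to every other element with that code.
  ... | a , a≤ | yes (a′ , a′≡k) with ≤-total em (f a) (f a′)
  ...   | inj₁ a≤a′ = a , λ where
    b (here b≡k)   → ≤-trans {f a} {f a′} {f b} a≤a′ (code-≤ (trans a′≡k (sym b≡k)))
    b (there b∈ks) → a≤ b b∈ks
  ...   | inj₂ a′≤a = a′ , λ where
    b (here b≡k)   → code-≤ (trans a′≡k (sym b≡k))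
    b (there b∈ks) → ≤-trans {f a′} {f a} {f b} a′≤a (a≤ b b∈ks)
... | a , a≤ = a , λ b → a≤ b (∈-allFin (code b))

-- Sums over finite sets

T-does : ∀ {P : Set} (P? : Dec P) → T (does P?) ⇔ P
T-does (yes p) = mk⇔ (λ _ → p) _
T-does (no ¬p) = mk⇔ (λ ()) ¬p

_≟ₐ_ : ∀ {N} (e f : Fin N × Fin N) → Dec (e ≡ f)
_≟ₐ_ = ≡-dec _≟_ _≟_

module _ {N : ℕ} where
  open DecMembership (_≟ₐ_ {N}) public using (_∈?_)

arcIn : ∀ {N} → List (Fin N × Fin N) → Digraph N
arcIn L i j = does ((i , j) ∈? L)

arcIn⇔∈ : ∀ {N} (L : List (Fin N × Fin N)) i j → T (arcIn L i j) ⇔ (i , j) ∈ L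
arcIn⇔∈ L i j = T-does ((i , j) ∈? L)

-- Needed over two monoids: `ℕ` to count degrees and `ℝ` under `_≐_` to add weights. Over `ℝ`,
-- `∑arcs` and `sumList` unfold to `arcSum` and `sumᴸ`.
module FiniteSums {a ℓ} (M : CommutativeMonoid a ℓ) where
  open CommutativeMonoid M
    renaming (refl to ≈-refl; sym to ≈-sym; trans to ≈-trans)
  open CommutativeMonoidSum M renaming (sum to ∑)
  open SetoidReasoning setoid

  sumList : List Carrier → Carrier
  sumList = foldr _∙_ ε

  ∑-zero : ∀ {n} (f : Fin n → Carrier) → (∀ i → f i ≈ ε) → ∑ f ≈ ε
  ∑-zero {n} f f≈ε = ≈-trans (sum-cong-≋ f≈ε) (sum-replicate-zero n)

  ∑-single : ∀ {n} (f : Fin n → Carrier) i → (∀ j → j ≢ i → f j ≈ ε) → ∑ f ≈ f i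
  ∑-single f zero    f≈ε =
    ≈-trans (∙-congˡ (∑-zero (f ∘ suc) λ j → f≈ε (suc j) λ ())) (identityʳ (f zero))
  ∑-single f (suc i) f≈ε =
    ≈-trans (∙-cong (f≈ε zero λ ())
        (∑-single (f ∘ suc) i λ j j≢i → f≈ε (suc j) (j≢i ∘ suc-injective)))
      (identityˡ (f (suc i)))

  sumList-lookup : ∀ {A : Set} (g : A → Carrier) xs →
    sumList (map g xs) ≈ ∑ (λ p → g (lookup xs p))
  sumList-lookup g []       = ≈-refl
  sumList-lookup g (x ∷ xs) = ∙-congˡ (sumList-lookup g xs)

  sumList-++ : ∀ {A : Set} (g : A → Carrier) xs ys →
    sumList (map g (xs ++ ys)) ≈ sumList (map g xs) ∙ sumList (map g ys)
  sumList-++ g []       ys = ≈-sym (identityˡ _)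
  sumList-++ g (x ∷ xs) ys = ≈-trans (∙-congˡ (sumList-++ g xs ys)) (≈-sym (assoc _ _ _))

  sumList-∷ʳ : ∀ {A : Set} (g : A → Carrier) xs x →
    sumList (map g (xs ∷ʳ x)) ≈ sumList (map g (x ∷ xs))
  sumList-∷ʳ g xs x =
    ≈-trans (sumList-++ g xs (x ∷ [])) (≈-trans (comm _ _) (∙-congʳ (identityʳ (g x))))

  sumList-concat : ∀ {A : Set} (g : A → Carrier) {m} (xss : Fin m → List A) →
    sumList (map g (concat (tabulate xss))) ≈ ∑ (λ k → sumList (map g (xss k)))
  sumList-concat g {ℕ.zero}  xss = ≈-refl
  sumList-concat g {ℕ.suc m} xss =
    ≈-trans (sumList-++ g (xss zero) _) (∙-congˡ (sumList-concat g (xss ∘ suc)))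

  infix 8 _?∙_

  _?∙_ : Bool → Carrier → Carrier
  b ?∙ x = if b then x else ε

  ?∙-⊎ : ∀ {b b₁ b₂} x → (T b ⇔ (T b₁ ⊎ T b₂)) → ¬ (T b₁ × T b₂) →
    b ?∙ x ≈ b₁ ?∙ x ∙ b₂ ?∙ x
  ?∙-⊎ {b}     {true}  {true}  x e d = contradiction _ d
  ?∙-⊎ {true}  {true}  {false} x e d = ≈-sym (identityʳ x)
  ?∙-⊎ {false} {true}  {b₂}    x e d = contradiction (inj₁ _) (from e)
  ?∙-⊎ {true}  {false} {true}  x e d = ≈-sym (identityˡ x)
  ?∙-⊎ {false} {false} {true}  x e d = contradiction (inj₂ _) (from e)
  ?∙-⊎ {true}  {false} {false} x e d = case to e _ of λ { (inj₁ ()) ; (inj₂ ()) }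
  ?∙-⊎ {false} {false} {false} x e d = ≈-sym (identityˡ ε)

  ?∙-ε : ∀ b → b ?∙ ε ≈ ε
  ?∙-ε true  = ≈-refl
  ?∙-ε false = ≈-refl

  ?∙-true : ∀ {b} x → T b → b ?∙ x ≈ x
  ?∙-true {true} x _ = ≈-refl

  ?∙-false : ∀ {b} x → ¬ T b → b ?∙ x ≈ ε
  ?∙-false {true}  x ¬b = contradiction _ ¬b
  ?∙-false {false} x ¬b = ≈-refl

  ∑arcs : ∀ {N} → Digraph N → (Fin N → Fin N → Carrier) → Carrier
  ∑arcs G c = ∑ λ i → ∑ λ j → G i j ?∙ c i j

  ∑arcs-cong : ∀ {N} {G H : Digraph N} c → (∀ i j → G i j ≡ H i j) → ∑arcs G c ≈ ∑arcs H c
  ∑arcs-cong c G≗H = sum-cong-≋ λ i → sum-cong-≋ λ j → reflexive (cong (_?∙ c i j) (G≗H i j))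

  -- Additivity over a disjoint union of arc sets. It serves both to split one arc off a list and to
  -- split the complete graph into a subgraph and its complement.
  ∑arcs-⊎ : ∀ {N} (G H₁ H₂ : Digraph N) c →
    (∀ i j → T (G i j) ⇔ (T (H₁ i j) ⊎ T (H₂ i j))) →
    (∀ i j → ¬ (T (H₁ i j) × T (H₂ i j))) →
    ∑arcs G c ≈ ∑arcs H₁ c ∙ ∑arcs H₂ c
  ∑arcs-⊎ G H₁ H₂ c e d = begin
    ∑arcs G c
      ≈⟨ sum-cong-≋ (λ i → sum-cong-≋ λ j → ?∙-⊎ (c i j) (e i j) (d i j)) ⟩
    ∑ (λ i → ∑ λ j → H₁ i j ?∙ c i j ∙ H₂ i j ?∙ c i j)
      ≈⟨ sum-cong-≋ (λ i → ∑-distrib-+ (λ j → H₁ i j ?∙ c i j) (λ j → H₂ i j ?∙ c i j)) ⟩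
    ∑ (λ i → ∑ (λ j → H₁ i j ?∙ c i j) ∙ ∑ (λ j → H₂ i j ?∙ c i j))
      ≈⟨ ∑-distrib-+ (λ i → ∑ λ j → H₁ i j ?∙ c i j) (λ i → ∑ λ j → H₂ i j ?∙ c i j) ⟩
    ∑arcs H₁ c ∙ ∑arcs H₂ c ∎

  ∑arcs-zero : ∀ {N} (G : Digraph N) → ∑arcs G (λ _ _ → ε) ≈ ε
  ∑arcs-zero G = ∑-zero _ λ i → ∑-zero _ λ j → ?∙-ε (G i j)

  ∑arcs-single : ∀ {N} (G : Digraph N) c e → (∀ i j → T (G i j) ⇔ (i , j) ≡ e) →
    ∑arcs G c ≈ uncurry c e
  ∑arcs-single G c (i , j) G⇔ = begin
    ∑arcs G c
      ≈⟨ ∑-single _ i (λ i′ i′≢i → ∑-zero _ λ j′ →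
           ?∙-false (c i′ j′) (i′≢i ∘ cong proj₁ ∘ to (G⇔ i′ j′))) ⟩
    ∑ (λ j′ → G i j′ ?∙ c i j′)
      ≈⟨ ∑-single _ j (λ j′ j′≢j → ?∙-false (c i j′) (j′≢j ∘ cong proj₂ ∘ to (G⇔ i j′))) ⟩
    G i j ?∙ c i j
      ≈⟨ ?∙-true (c i j) (from (G⇔ i j) refl) ⟩
    c i j ∎

  -- The bridge from sums over a graph to sums along routes. Induction on the list: the head is
  -- split off as a one-arc graph, and uniqueness keeps it disjoint from the tail.
  ∑arcs-list : ∀ {N} (G : Digraph N) c {L} → Unique L → (∀ i j → T (G i j) ⇔ (i , j) ∈ L) →
    ∑arcs G c ≈ sumList (map (uncurry c) L)
  ∑arcs-list G c []                  G⇔ =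
    ∑-zero _ λ i → ∑-zero _ λ j → ?∙-false (c i j) λ g → case to (G⇔ i j) g of λ ()
  ∑arcs-list G c {e ∷ L} (e∉L ∷ L!) G⇔ = begin
    ∑arcs G c                                  ≈⟨ ∑arcs-⊎ G [e] (arcIn L) c split disjoint ⟩
    ∑arcs [e] c ∙ ∑arcs (arcIn L) c
      ≈⟨ ∙-cong (∑arcs-single [e] c e λ i j → T-does ((i , j) ≟ₐ e))
                -- The induction continues with the graph of the remaining arcs in place of `G`.
                (∑arcs-list (arcIn L) c L! (arcIn⇔∈ L)) ⟩
    uncurry c e ∙ sumList (map (uncurry c) L)  ∎
    where
    [e] : Digraph _
    [e] i j = does ((i , j) ≟ₐ e)
    split : ∀ i j → T (G i j) ⇔ (T ([e] i j) ⊎ T (arcIn L i j))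
    split i j = mk⇔
      (λ g → case to (G⇔ i j) g of λ where
        (here eq)   → inj₁ (from (T-does ((i , j) ≟ₐ e)) eq)
        (there e∈L) → inj₂ (from (arcIn⇔∈ L i j) e∈L))
      λ where
        (inj₁ g) → from (G⇔ i j) (here (to (T-does ((i , j) ≟ₐ e)) g))
        (inj₂ g) → from (G⇔ i j) (there (to (arcIn⇔∈ L i j) g))
    disjoint : ∀ i j → ¬ (T ([e] i j) × T (arcIn L i j))
    disjoint i j (g , h) =
      All.lookup e∉L (to (arcIn⇔∈ L i j) h) (sym (to (T-does ((i , j) ≟ₐ e)) g))

module Σℕ = FiniteSums ℕ.+-0-commutativeMonoid
module Σℝ = FiniteSums ≐.commutativeMonoid
module ∑ℕ = CommutativeMonoidSum ℕ.+-0-commutativeMonoid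

-- Degrees

δ : ∀ {N} → Fin N → Fin N → ℕ
δ j i = if does (i ≟ j) then 1 else 0

δ-refl : ∀ {N} (i : Fin N) → δ i i ≡ 1
δ-refl i = cong (if_then 1 else 0) (dec-true (i ≟ i) refl)

δ-≢ : ∀ {N} {i j : Fin N} → i ≢ j → δ j i ≡ 0
δ-≢ {i = i} {j} i≢j = cong (if_then 1 else 0) (dec-false (i ≟ j) i≢j)

∣tabulate∣ : ∀ {N} (g : Fin N → Bool) → ∣ Vec.tabulate g ∣ ≡ ∑ℕ.sum (λ j → if g j then 1 else 0)
∣tabulate∣ {ℕ.zero}  g = refl
∣tabulate∣ {ℕ.suc N} g with g zero
... | true  = cong ℕ.suc (∣tabulate∣ (g ∘ suc))
... | false = ∣tabulate∣ (g ∘ suc)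

-- Extracts an actual arc from a positive degree.
∣tabulate∣>0 : ∀ {N k} (g : Fin N → Bool) → ∣ Vec.tabulate g ∣ ≡ ℕ.suc k → ∃ λ j → T (g j)
∣tabulate∣>0 {ℕ.suc N} g eq with g zero in g₀
... | true  = zero , subst T (sym g₀) _
... | false with ∣tabulate∣>0 (g ∘ suc) eq
...   | j , gj = suc j , gj

-- The out-degree of `v` is the arc sum for the cost that is 1 on arcs leaving `v` and 0 elsewhere,
-- so `∑arcs-list` applies.
outdeg-arcs : ∀ {N} (G : Digraph N) {L} → Unique L → (∀ i j → T (G i j) ⇔ (i , j) ∈ L) →
  ∀ v → outdeg G v ≡ Σℕ.sumList (map (δ v) (map proj₁ L))
outdeg-arcs G {L} L! G⇔ v = begin
  outdeg G v                                ≡⟨ ∣tabulate∣ (G v) ⟩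
  ∑ℕ.sum (λ j → if G v j then 1 else 0)
    -- Writing 1 as `δ v v` turns the sum into row `v` of a double sum whose other rows vanish.
    ≡⟨ ∑ℕ.sum-cong-≗ (λ j → cong (if G v j then_else 0) (δ-refl v)) ⟨
  ∑ℕ.sum (λ j → if G v j then δ v v else 0)
    ≡⟨ Σℕ.∑-single _ v (λ i i≢v → Σℕ.∑-zero _ λ j →
         trans (cong (if G i j then_else 0) (δ-≢ i≢v)) (Σℕ.?∙-ε (G i j))) ⟨
  Σℕ.∑arcs G (λ i _ → δ v i)            ≡⟨ Σℕ.∑arcs-list G (λ i _ → δ v i) L! G⇔ ⟩
  Σℕ.sumList (map (δ v ∘ proj₁) L)      ≡⟨ cong Σℕ.sumList (map-∘ L) ⟩
  Σℕ.sumList (map (δ v) (map proj₁ L))    ∎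
  where open ≡-Reasoning

indeg-arcs : ∀ {N} (G : Digraph N) {L} → Unique L → (∀ i j → T (G i j) ⇔ (i , j) ∈ L) →
  ∀ v → indeg G v ≡ Σℕ.sumList (map (δ v) (map proj₂ L))
indeg-arcs G {L} L! G⇔ v = begin
  indeg G v                                 ≡⟨ ∣tabulate∣ (λ i → G i v) ⟩
  ∑ℕ.sum (λ i → if G i v then 1 else 0)
    ≡⟨ ∑ℕ.sum-cong-≗ (λ i → cong (if G i v then_else 0) (δ-refl v)) ⟨
  ∑ℕ.sum (λ i → if G i v then δ v v else 0)
    -- Here each row separately collapses to its entry in column `v`.
    ≡⟨ ∑ℕ.sum-cong-≗ (λ i → Σℕ.∑-single _ v (λ j j≢v →
         trans (cong (if G i j then_else 0) (δ-≢ j≢v)) (Σℕ.?∙-ε (G i j)))) ⟨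
  Σℕ.∑arcs G (λ _ j → δ v j)            ≡⟨ Σℕ.∑arcs-list G (λ _ j → δ v j) L! G⇔ ⟩
  Σℕ.sumList (map (δ v ∘ proj₂) L)      ≡⟨ cong Σℕ.sumList (map-∘ L) ⟩
  Σℕ.sumList (map (δ v) (map proj₂ L))    ∎
  where open ≡-Reasoning

-- Closed walks

module _ {A : Set} where

  consecutive-sources : ∀ (x : A) ys z → map proj₁ (consecutive (x ∷ ys ∷ʳ z)) ≡ x ∷ ys
  consecutive-sources x []       z = refl
  consecutive-sources x (y ∷ ys) z = cong (x ∷_) (consecutive-sources y ys z)

  consecutive-targets : ∀ (x : A) ys z → map proj₂ (consecutive (x ∷ ys ∷ʳ z)) ≡ ys ∷ʳ z
  consecutive-targets x []       z = refl
  consecutive-targets x (y ∷ ys) z = cong (y ∷_) (consecutive-targets y ys z)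

  consecutive-distinct : ∀ {xs} → Unique xs → ∀ {i j : A} → (i , j) ∈ consecutive xs → i ≢ j
  consecutive-distinct {x ∷ y ∷ xs} ((x≢y All.∷ _) ∷ _) (here refl) = x≢y
  consecutive-distinct {x ∷ y ∷ xs} (_ ∷ xs!)           (there e∈)  = consecutive-distinct xs! e∈

  unique-∷ʳ : ∀ {xs} {x : A} → Unique xs → x ∉ xs → Unique (xs ∷ʳ x)
  unique-∷ʳ xs! x∉xs = Unique.++⁺ xs! (All.[] ∷ []) λ { (v∈xs , here refl) → x∉xs v∈xs }

  index-unique : ∀ {xs} → Unique xs → ∀ p q → lookup xs p ≡ lookup {A = A} xs q → p ≡ q
  index-unique (_ ∷ _)      zero    zero    _  = refl
  index-unique (x∉xs ∷ _)   zero    (suc q) eq =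
    contradiction eq (All.lookup x∉xs (∈-lookup q))
  index-unique (x∉xs ∷ _)   (suc p) zero    eq =
    contradiction (sym eq) (All.lookup x∉xs (∈-lookup p))
  index-unique (_ ∷ xs!)    (suc p) (suc q) eq = cong suc (index-unique xs! p q eq)

-- Tours and their arcs

module Routes (I : Instance) where
  open Instance I

  private
    V = Vertex I
    0ᵛ = depot I

  module _ (t : Tour I) where

    arc-sources : map proj₁ (arcs I t) ≡ 0ᵛ ∷ map suc (toList t)
    arc-sources = consecutive-sources 0ᵛ (map suc (toList t)) 0ᵛ

    arc-targets : map proj₂ (arcs I t) ≡ map suc (toList t) ∷ʳ 0ᵛ
    arc-targets = consecutive-targets 0ᵛ (map suc (toList t)) 0ᵛ

    source∈ : ∀ {i j} → (i , j) ∈ arcs I t → i ∈ 0ᵛ ∷ map suc (toList t)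
    source∈ {i} e∈ = subst (i ∈_) arc-sources (∈-map⁺ proj₁ e∈)

    source∈vertices : ∀ {i j} → (i , j) ∈ arcs I t → i ∈ vertices I t
    source∈vertices e∈ = ∈-++⁺ˡ (source∈ e∈)

    target∈vertices : ∀ {i j} → (i , j) ∈ arcs I t → j ∈ vertices I t
    target∈vertices {j = j} e∈ = there (subst (j ∈_) arc-targets (∈-map⁺ proj₂ e∈))

    customer∈ : ∀ {c} → suc c ∈ map suc (toList t) → c ∈ toList t
    customer∈ sc∈ with ∈-map⁻ suc sc∈
    ... | _ , c∈ , refl = c∈

    customer∈vertices : ∀ {c} → c ∈ toList t → suc c ∈ vertices I t
    customer∈vertices c∈ = there (∈-++⁺ˡ (∈-map⁺ suc c∈))

    vertices∈ : ∀ {v} → v ∈ vertices I t → v ≡ 0ᵛ ⊎ ∃ λ c → v ≡ suc c × c ∈ toList t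
    vertices∈ (here v≡0) = inj₁ v≡0
    vertices∈ (there v∈) with ∈-++⁻ (map suc (toList t)) v∈
    ... | inj₂ (here v≡0) = inj₁ v≡0
    ... | inj₁ v∈′ with ∈-map⁻ suc v∈′
    ...   | c , c∈ , v≡ = inj₂ (c , v≡ , c∈)

    0∉customers : 0ᵛ ∉ map suc (toList t)
    0∉customers 0∈ with ∈-map⁻ suc 0∈
    ... | _ , _ , ()

    module _ (t! : Unique (toList t)) where

      sources-unique : Unique (0ᵛ ∷ map suc (toList t))
      sources-unique = All.¬Any⇒All¬ _ 0∉customers ∷ Unique.map⁺ suc-injective t!

      -- Distinct arcs are already told apart by their sources, which are the depot followed by
      -- distinct customers.
      arcs-unique : Unique (arcs I t)
      arcs-unique = Unique.map⁻ (subst Unique (sym arc-sources) sources-unique)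

  -- The vertex list contains the depot twice, so it is not duplicate-free. The first arc goes from
  -- the depot to a customer; without the opening depot the list has no repetition, and neighbours
  -- in it differ.
  arcs-loopless : ∀ t → Unique (toList t) → ∀ {i j} → (i , j) ∈ arcs I t → i ≢ j
  arcs-loopless (c ∷⁺ cs) t! (here refl) = λ ()
  arcs-loopless (c ∷⁺ cs) t! (there e∈)  = consecutive-distinct
    (unique-∷ʳ (Unique.map⁺ suc-injective t!) (0∉customers (c ∷⁺ cs))) e∈

  visits-0 : ∀ t → Σℕ.sumList (map (δ 0ᵛ) (0ᵛ ∷ map suc (toList t))) ≡ 1
  visits-0 t = cong ℕ.suc (go (toList t))
    where
    go : ∀ cs → Σℕ.sumList (map (δ 0ᵛ) (map suc cs)) ≡ 0
    go []       = refl
    go (c ∷ cs) = go cs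

  visits-suc : ∀ c t → Σℕ.sumList (map (δ (suc c)) (0ᵛ ∷ map suc (toList t))) ≡
    ∑ℕ.sum (λ p → δ c (lookup (toList t) p))
  visits-suc c t = trans (go (toList t)) (Σℕ.sumList-lookup (δ c) (toList t))
    where
    go : ∀ cs → Σℕ.sumList (map (δ (suc c)) (map suc cs)) ≡ Σℕ.sumList (map (δ c) cs)
    go []        = refl
    go (c′ ∷ cs) = cong (δ c c′ ℕ.+_) (go cs)

  -- Arcs and visits of a family of tours

  module Family (R : Fin m → Tour I) where

    arcList : List (V × V)
    arcList = concat (tabulate (λ k → arcs I (R k)))

    ∈-arcList : ∀ {e} → e ∈ arcList ⇔ ∃ λ k → e ∈ arcs I (R k)
    ∈-arcList = mk⇔
      (λ e∈ → case ∈-concat⁻′ (tabulate (λ k → arcs I (R k))) e∈ of λ where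
        (es , e∈es , es∈) → case ∈-tabulate⁻ es∈ of λ where
          (k , refl) → k , e∈es)
      (λ (k , e∈) → ∈-concat⁺′ e∈ (∈-tabulate⁺ k))

    EdgeDisjoint : Set
    EdgeDisjoint = ∀ {k l e} → k ≢ l → e ∈ arcs I (R k) → ¬ e ∈ arcs I (R l)

    arcList-unique : (∀ k → Unique (toList (R k))) → EdgeDisjoint → Unique arcList
    arcList-unique simple disjoint = Unique.concat⁺
      (All.tabulate⁺ λ k → arcs-unique (R k) (simple k))
      (AllPairs.tabulate⁺ λ k≢l (e∈k , e∈l) → disjoint k≢l e∈k e∈l)

    -- The closing depot of a tour is left out: each visit is then the source
    -- of one arc and the target of one arc.
    visits : V → ℕ
    visits v = ∑ℕ.sum λ k → Σℕ.sumList (map (δ v) (0ᵛ ∷ map suc (toList (R k))))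

    sources-visits : ∀ v → Σℕ.sumList (map (δ v) (map proj₁ arcList)) ≡ visits v
    sources-visits v = begin
      Σℕ.sumList (map (δ v) (map proj₁ arcList))       ≡⟨ cong Σℕ.sumList (map-∘ arcList) ⟨
      Σℕ.sumList (map (δ v ∘ proj₁) arcList)         ≡⟨ Σℕ.sumList-concat _ (λ k → arcs I (R k)) ⟩
      ∑ℕ.sum (λ k → Σℕ.sumList (map (δ v ∘ proj₁) (arcs I (R k))))
        ≡⟨ ∑ℕ.sum-cong-≗ (λ k → cong Σℕ.sumList (trans (map-∘ (arcs I (R k)))
             (cong (map (δ v)) (arc-sources (R k))))) ⟩
      visits v                                           ∎
      where open ≡-Reasoning

    targets-visits : ∀ v → Σℕ.sumList (map (δ v) (map proj₂ arcList)) ≡ visits v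
    targets-visits v = begin
      Σℕ.sumList (map (δ v) (map proj₂ arcList))       ≡⟨ cong Σℕ.sumList (map-∘ arcList) ⟨
      Σℕ.sumList (map (δ v ∘ proj₂) arcList)         ≡⟨ Σℕ.sumList-concat _ (λ k → arcs I (R k)) ⟩
      ∑ℕ.sum (λ k → Σℕ.sumList (map (δ v ∘ proj₂) (arcs I (R k))))
        ≡⟨ ∑ℕ.sum-cong-≗ (λ k → trans
             (cong Σℕ.sumList (trans (map-∘ (arcs I (R k))) (cong (map (δ v)) (arc-targets (R k)))))
             -- The targets end with the depot where the sources begin with it; commutativity moves
             -- it to the front.
             (Σℕ.sumList-∷ʳ (δ v) (map suc (toList (R k))) 0ᵛ)) ⟩
      visits v                                           ∎
      where open ≡-Reasoning

    visits-depot : visits 0ᵛ ≡ m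
    visits-depot = trans (∑ℕ.sum-cong-≗ λ k → visits-0 (R k)) (ones m)
      where
      ones : ∀ k → ∑ℕ.sum {k} (λ _ → 1) ≡ k
      ones ℕ.zero    = refl
      ones (ℕ.suc k) = cong ℕ.suc (ones k)

  -- From feasible solutions to feasible graphs

  module Solution {R} (feasible : IsFeasibleSolution I R) where
    open IsFeasibleSolution feasible
    open Family R

    position-unique : ∀ {pos pos′} → customerAt I R pos ≡ customerAt I R pos′ → pos ≡ pos′
    position-unique {pos} {pos′} eq with exactly-once (customerAt I R pos′)
    ... | _ , _ , unique = trans (sym (unique eq)) (unique refl)

    route-unique : ∀ {k l c} → c ∈ toList (R k) → c ∈ toList (R l) → k ≡ l
    route-unique {k} {l} c∈k c∈l = cong proj₁ (position-unique {k , index c∈k} {l , index c∈l}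
      (trans (sym (lookup-index c∈k)) (lookup-index c∈l)))

    -- A repeated customer would occupy two positions of the same route.
    simple : ∀ k → Unique (toList (R k))
    simple k = subst Unique (tabulate-lookup (toList (R k)))
      (Unique.tabulate⁺ λ {p} {q} eq → case position-unique {k , p} {k , q} eq of λ { refl → refl })

    share-depot : ∀ {k l v} → k ≢ l → v ∈ vertices I (R k) → v ∈ vertices I (R l) → v ≡ 0ᵛ
    share-depot {k} {l} k≢l v∈k v∈l with vertices∈ (R k) v∈k | vertices∈ (R l) v∈l
    ... | inj₁ v≡0              | _                      = v≡0
    ... | inj₂ _                | inj₁ v≡0               = v≡0
    ... | inj₂ (_ , refl , c∈k) | inj₂ (_ , refl , c∈l) =
      contradiction (route-unique c∈k c∈l) k≢l

    -- Both ends of a common arc would be vertices shared by two routes, hence both the depot, and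
    -- the arc would be a loop.
    edge-disjoint : EdgeDisjoint
    edge-disjoint {k} {l} k≢l e∈k e∈l = arcs-loopless (R k) (simple k) e∈k (trans
      (share-depot k≢l (source∈vertices (R k) e∈k) (source∈vertices (R l) e∈l))
      (sym (share-depot k≢l (target∈vertices (R k) e∈k) (target∈vertices (R l) e∈l))))

    -- Counted over all positions of all routes, `δ c` has exactly one nonzero term, at the unique
    -- position of `c`.
    visits-customer : ∀ c → visits (suc c) ≡ 1
    visits-customer c with exactly-once c
    ... | (k , p) , at-c , unique = begin
      visits (suc c)                                      ≡⟨ ∑ℕ.sum-cong-≗ (λ l → visits-suc c (R l)) ⟩
      ∑ℕ.sum (λ l → ∑ℕ.sum (λ q → δ c (customerAt I R (l , q))))
        ≡⟨ Σℕ.∑-single _ k (λ l l≢k → Σℕ.∑-zero _ λ q → δ-≢ λ eq →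
             l≢k (sym (cong proj₁ (unique {l , q} eq)))) ⟩
      ∑ℕ.sum (λ q → δ c (customerAt I R (k , q)))
        ≡⟨ Σℕ.∑-single _ p (λ q q≢p → δ-≢ λ eq →
             case unique {k , q} eq of λ { refl → q≢p refl }) ⟩
      δ c (customerAt I R (k , p))                      ≡⟨ cong (δ c) at-c ⟩
      δ c c                                           ≡⟨ δ-refl c ⟩
      1                                                   ∎
      where open ≡-Reasoning

    graph : Digraph (ℕ.suc n)
    graph = arcIn arcList

    graph⇔ : ∀ i j → T (graph i j) ⇔ (i , j) ∈ arcList
    graph⇔ = arcIn⇔∈ arcList

    arcList! : Unique arcList
    arcList! = arcList-unique simple edge-disjoint

    graph-out : ∀ v → outdeg graph v ≡ visits v
    graph-out v = trans (outdeg-arcs graph arcList! graph⇔ v) (sources-visits v)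

    graph-in : ∀ v → indeg graph v ≡ visits v
    graph-in v = trans (indeg-arcs graph arcList! graph⇔ v) (targets-visits v)

    graph-edges : ∀ i j → T (graph i j) ⇔ ∃ λ k → (i , j) ∈ arcs I (R k)
    graph-edges i j = mk⇔ (to ∈-arcList ∘ to (graph⇔ i j)) (from (graph⇔ i j) ∘ from ∈-arcList)

    graph-feasible : IsFeasibleGraph I graph
    graph-feasible = record
      { subgraph      = λ i j g → let k , e∈ = to (graph-edges i j) g in
          subst T (sym (cong not (dec-false (i ≟ j) (arcs-loopless (R k) (simple k) e∈)))) _
      ; depot-out     = trans (graph-out 0ᵛ) visits-depot
      ; depot-in      = trans (graph-in 0ᵛ) visits-depot
      ; customer-out  = λ c → trans (graph-out (suc c)) (visits-customer c)
      ; customer-in   = λ c → trans (graph-in (suc c)) (visits-customer c)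
      ; cycles        = R
      ; decomposition = record
        { simple        = simple
        ; edges         = graph-edges
        ; edge-disjoint = edge-disjoint
        ; share-depot   = share-depot
        }
      ; capacity      = capacity
      }

  toGraph : FeasibleSolution I → FeasibleGraph I
  toGraph (R , feasible) = _ , Solution.graph-feasible feasible

  -- From feasible graphs to feasible solutions

  toSolution : FeasibleGraph I → FeasibleSolution I
  toSolution (G , feasible) = cycles , record { exactly-once = exactly-once ; capacity = capacity }
    where
    open IsFeasibleGraph feasible
    open IsCycleDecomposition decomposition
    exactly-once : ∀ c → _
    -- Existence: out-degree 1 yields an arc leaving `c`, and that arc lies on some cycle, which
    -- therefore visits `c`.
    exactly-once c with ∣tabulate∣>0 (G (suc c)) (customer-out c)
    ... | j , g with to (edges (suc c) j) g
    ... | k , e∈ with source∈ (cycles k) e∈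
    -- The source is a customer, so it is not the opening depot of the cycle.
    ... | there sc∈ = (k , index c∈) , sym (lookup-index c∈) , λ {pos} → unique {pos}
      where
      c∈ = customer∈ (cycles k) sc∈
      unique : ∀ {pos} → customerAt I cycles pos ≡ c → (k , index c∈) ≡ pos
      unique {l , q} eq with k ≟ l
      -- Within one cycle uniqueness comes from simplicity; across two cycles a second occurrence
      -- would be a shared vertex other than the depot.
      ... | yes refl = cong (k ,_)
        (index-unique (simple k) _ _ (trans (sym (lookup-index c∈)) (sym eq)))
      ... | no  k≢l  = case share-depot k≢l (customer∈vertices (cycles k) c∈)
        (customer∈vertices (cycles l) (subst (_∈ toList (cycles l)) eq (∈-lookup q))) of λ ()

  -- Cost, weight and edit distance

  weight : FeasibleGraph I → ℝ
  weight (G , _) = arcSum G w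

  -- The cycles, being simple and edge-disjoint, list every arc of the graph exactly once, so
  -- summing along them gives the weight.
  cost-toSolution : ∀ G → cost I (toSolution G) ≐ weight G
  cost-toSolution (G , feasible) p = sym (weight≐cost p)
    where
    open IsFeasibleGraph feasible
    open IsCycleDecomposition decomposition
    open Family cycles
    open SetoidReasoning ≐.setoid
    G⇔ : ∀ i j → T (G i j) ⇔ (i , j) ∈ arcList
    G⇔ i j = mk⇔ (from ∈-arcList ∘ to (edges i j)) (from (edges i j) ∘ to ∈-arcList)
    weight≐cost : arcSum G w ≐ sum λ k → length-of I (cycles k)
    weight≐cost = begin
      arcSum G w
        ≈⟨ Σℝ.∑arcs-list G w (arcList-unique simple edge-disjoint) G⇔ ⟩
      sumᴸ (map (uncurry w) arcList)
        ≈⟨ Σℝ.sumList-concat (uncurry w) (λ k → arcs I (cycles k)) ⟩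
      sum (λ k → length-of I (cycles k)) ∎

  -- Insertions are free, and the deleted arcs are exactly those of the complete graph outside the
  -- subgraph `G`; together with the arcs of `G` they make up all arcs.
  ged+weight : ∀ G → ged I G +ℝ weight G ≐ W-total I
  ged+weight (G , feasible) = begin
    arcSum (G-s I ∖ G) w +ℝ arcSum (G ∖ G-s I) (λ _ _ → 0ℝ) +ℝ arcSum G w
      ≈⟨ (λ p → cong (λ q → seq (arcSum (G-s I ∖ G) w) p ℚ.+ q ℚ.+ seq (arcSum G w) p)
           (Σℝ.∑arcs-zero (G ∖ G-s I) p)) ⟩
    arcSum (G-s I ∖ G) w +ℝ 0ℝ +ℝ arcSum G w
      ≈⟨ (λ p → cong (ℚ._+ seq (arcSum G w) p) (ℚ.+-identityʳ (seq (arcSum (G-s I ∖ G) w) p))) ⟩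
    arcSum (G-s I ∖ G) w +ℝ arcSum G w
      ≈⟨ Σℝ.∑arcs-⊎ (G-s I) (G-s I ∖ G) G w split (λ i j → disjoint (G-s I i j) (G i j)) ⟨
    W-total I ∎
    where
    open IsFeasibleGraph feasible
    open SetoidReasoning ≐.setoid
    ∖-⊎ : ∀ a b → (T b → T a) → T a ⇔ (T (a ∧ not b) ⊎ T b)
    ∖-⊎ true  true  _   = mk⇔ inj₂ _
    ∖-⊎ true  false _   = mk⇔ inj₁ _
    ∖-⊎ false true  b⇒a = contradiction _ b⇒a
    ∖-⊎ false false _   = mk⇔ inj₁ λ { (inj₁ ()) ; (inj₂ ()) }
    split : ∀ i j → T (G-s I i j) ⇔ (T ((G-s I ∖ G) i j) ⊎ T (G i j))
    split i j = ∖-⊎ (G-s I i j) (G i j) (subgraph i j)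
    disjoint : ∀ a b → ¬ (T (a ∧ not b) × T b)
    disjoint true  true  (() , _)
    disjoint true  false (_ , ())
    disjoint false _     (() , _)

  ged-≐ : ∀ G → ged I G ≐ W-total I -ℝ weight G
  ged-≐ G p = trans (sym (ℚ+.//-rightDividesʳ b a)) (cong (ℚ._- b) (ged+weight G p))
    where
    a = seq (ged I G) p
    b = seq (weight G) p

  weight-≐ : ∀ G → weight G ≐ W-total I -ℝ ged I G
  weight-≐ G p = trans (sym (ℚ+.//-rightDividesʳ a b))
    (cong (ℚ._- a) (trans (ℚ.+-comm b a) (ged+weight G p)))
    where
    a = seq (ged I G) p
    b = seq (weight G) p

  -- Existence of a lightest feasible graph

  row : FeasibleGraph I → Vertex I → Vertex I → Fin 2
  row (G , _) i j = Inverse.from 2↔Bool (G i j)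

  -- Only the adjacency matrix is encoded, row by row, and not the chosen cycles or the proofs: the
  -- weight depends on nothing else.
  code : FeasibleGraph I → Fin ((2 ℕ.^ ℕ.suc n) ℕ.^ ℕ.suc n)
  code G = funToFin (funToFin ∘ row G)

  code-injective : ∀ {G H} → code G ≡ code H → ∀ i j → proj₁ G i j ≡ proj₁ H i j
  code-injective {G} {H} eq i j =
    trans (sym (strictlyInverseˡ (proj₁ G i j)))
      (trans (cong decode (funToFin-injective (row G i) (row H i)
        (funToFin-injective (funToFin ∘ row G) (funToFin ∘ row H) eq i) j))
        (strictlyInverseˡ (proj₁ H i j)))
    where
    open Inverse 2↔Bool using (strictlyInverseˡ) renaming (to to decode)
    funToFin-injective : ∀ {k l} (f g : Fin k → Fin l) → funToFin f ≡ funToFin g → ∀ x → f x ≡ g x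
    funToFin-injective f g eq x = trans (sym (finToFun-funToFin f x))
      (trans (cong (λ h → finToFun h x) eq) (finToFun-funToFin g x))

  lightest : ExcludedMiddle 0ℓ → FeasibleGraph I →
    ∃ λ G → ∀ H → weight G ≤ℝ weight H
  lightest em = minimiser em weight code λ {G} {H} eq →
    ≤-reflexive {weight G} {weight H} (Σℝ.∑arcs-cong w (code-injective {G} {H} eq))

  -- The two extrema

  weight-toGraph : ∀ S → weight (toGraph S) ≐ cost I S
  -- `toGraph` stores the routes of `S` as its cycles and `toSolution` returns them, so both
  -- solutions have the same cost by computation.
  weight-toGraph S p = sym (cost-toSolution (toGraph S) p)

  isMinimum : ∀ {G} → (∀ H → weight G ≤ℝ weight H) → IsMinimum (cost I) [ W-total I -ℝ ged I G ]
  isMinimum {G} G≤ =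
    (toSolution G , ≐⇒≈ {cost I (toSolution G)} {W-total I -ℝ ged I G}
      λ p → trans (cost-toSolution G p) (weight-≐ G p)) ,
    -- Every solution costs as much as its graph weighs, and no graph is lighter than `G`.
    λ S → ≤-resp-≐ {weight G} {W-total I -ℝ ged I G} {weight (toGraph S)} {cost I S}
      (weight-≐ G) (weight-toGraph S) (G≤ (toGraph S))

  -- The edit distance is `W-total` minus the weight, so a lightest graph has the largest edit
  -- distance.
  isMaximum : ∀ {G} → (∀ H → weight G ≤ℝ weight H) → IsMaximum (ged I) [ ged I G ]
  isMaximum {G} G≤ =
    (G , ≐⇒≈ {ged I G} {ged I G} λ _ → refl) ,
    λ H → ≤-resp-≐ {W-total I -ℝ weight H} {ged I H} {W-total I -ℝ weight G} {ged I G}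
      (λ p → sym (ged-≐ H p)) (λ p → sym (ged-≐ G p))
      (-‿anti-≤ {weight G} {weight H} (W-total I) (G≤ H))

≈-refl : ∀ {x} → x ≈ℝ x
≈-refl {x} = ≐⇒≈ {x} {x} λ _ → refl

theorem1 : ExcludedMiddle 0ℓ → (I : Instance) →
    ∃₂ λ (min-cost max-ged : ℝ ±) →
    IsMinimum (cost I) min-cost × IsMaximum (ged I) max-ged ×
    min-cost ≈± (W-total I -± max-ged)
theorem1 em I with em {FeasibleGraph I}
-- Without feasible graphs there are no feasible solutions either, by `toGraph`; subtracting `⊥±`
-- gives `⊤±`, so the equation holds by computation.
... | no ¬G = ⊤± , ⊥± , ¬G ∘ Routes.toGraph I , ¬G , ≈±-refl (λ {x} → ≈-refl {x})
... | yes G = let G* , G*≤ = Routes.lightest I em G in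
  -- The minimum is presented literally as the right-hand side of the equation, which leaves only
  -- reflexivity to check.
  [ W-total I -ℝ ged I G* ] , [ ged I G* ] ,
  Routes.isMinimum I {G*} G*≤ , Routes.isMaximum I {G*} G*≤ , ≈±-refl (λ {x} → ≈-refl {x})
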